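{- Let $n = p^2$, where $p \geq 5$ is a prime number. Then the Wiener index of the line graph $L(\Gamma(\mathbb{Z}_{p^2}))$ is $W(L(\Gamma(\mathbb{Z}_{p^2}))) = \dfrac{1}{4}(p-1)(p-2)^2(p-3)$.
   Context: For a positive integer $n$, $\mathbb{Z}_n$ is the ring of residue classes modulo $n$. The zero-divisor graph $\Gamma(\mathbb{Z}_n)$ is the simple undirected graph whose vertices are the nonzero zero-divisors of $\mathbb{Z}_n$ (nonzero $x \in \mathbb{Z}_n$ such that $xy = 0$ for some nonzero $y \in \mathbb{Z}_n$), with distinct vertices $x,y$ adjacent if and only if $xy=0$. The line graph $L(\Gamma(\mathbb{Z}_n))$ is the graph whose vertices are the edges of $\Gamma(\mathbb{Z}_n)$, two distinct vertices being adjacent if the corresponding edges share a common vertex in $\Gamma(\mathbb{Z}_n)$. The Wiener index of a finite connected graph $G$ with vertex set $V$ is $W(G) = \frac{1}{2}\sum_{x,y \in V} d(x,y)$, the sum being over all ordered pairs $(x,y)$, where $d(x,y)$ is the length of a shortest path between $x$ and $y$. -}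

module Defs where

open import Algebra.Bundles using (CommutativeRing)
open import Data.Integer.Base using (ℤ; +_; 0ℤ; 1ℤ; _+_; _-_; _*_; -_)
open import Data.Integer.Divisibility.Signed
  using (_∣_; divides; ∣m∣n⇒∣m+n; ∣m⇒∣-m; ∣n⇒∣m*n)
import Data.Integer.Properties as ℤ
open import Data.Integer.Tactic.RingSolver using (solve-∀)
open import Data.List.Base using (List; _∷_; [_]; cartesianProductWith)
import Data.List.Relation.Unary.Enumerates.Setoid as Enumerates
import Data.List.Relation.Unary.Unique.Setoid as Unique
open import Data.Nat.Base as ℕ using (ℕ; zero; suc)
open import Data.Nat.ListAction using (sum)
open import Data.Product.Base using (Σ-syntax; ∃-syntax; _×_; _,_; proj₁)
open import Data.Rational.Base as ℚ using (ℚ; ½; _/_)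
open import Data.Sum.Base using (_⊎_; inj₁; inj₂)
open import Level using (0ℓ)
open import Relation.Binary.Bundles using (Setoid)
open import Relation.Binary.Core using (Rel)
open import Relation.Binary.Definitions using (Symmetric; Irreflexive; _Respects₂_)
open import Relation.Binary.PropositionalEquality.Core
  using (_≡_; refl; subst)
import Relation.Binary.Construct.On as On
open import Relation.Nullary.Negation.Core using (¬_)

-- Residue classes modulo n are integers with congruence as setoid equality.

infix 4 _≡_[mod_]

-- A record rather than a plain synonym, so that x and y can be inferred.
record _≡_[mod_] (x y : ℤ) (n : ℕ) : Set where
  constructor congruent
  field
    n∣x-y : + n ∣ x - y

private
  module Mod (n : ℕ) where

    by : ∀ {x y z} → + n ∣ z → z ≡ x - y → x ≡ y [mod n ]
    by n∣z eq = congruent (subst (+ n ∣_) eq n∣z)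

    reflexive : ∀ {x y} → x ≡ y → x ≡ y [mod n ]
    reflexive {x} refl = congruent (divides 0ℤ (ℤ.+-inverseʳ x))

    symmetric : ∀ {x y} → x ≡ y [mod n ] → y ≡ x [mod n ]
    symmetric {x} {y} (congruent p) = by (∣m⇒∣-m p) (eq x y)
      where
      eq : ∀ x y → - (x - y) ≡ y - x
      eq = solve-∀

    transitive : ∀ {x y z} → x ≡ y [mod n ] → y ≡ z [mod n ] → x ≡ z [mod n ]
    transitive {x} {y} {z} (congruent p) (congruent q) =
      by (∣m∣n⇒∣m+n p q) (eq x y z)
      where
      eq : ∀ x y z → (x - y) + (y - z) ≡ x - z
      eq = solve-∀

    +-cong : ∀ {x y u v} → x ≡ y [mod n ] → u ≡ v [mod n ] → x + u ≡ y + v [mod n ]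
    +-cong {x} {y} {u} {v} (congruent p) (congruent q) =
      by (∣m∣n⇒∣m+n p q) (eq x y u v)
      where
      eq : ∀ x y u v → (x - y) + (u - v) ≡ (x + u) - (y + v)
      eq = solve-∀

    *-cong : ∀ {x y u v} → x ≡ y [mod n ] → u ≡ v [mod n ] → x * u ≡ y * v [mod n ]
    *-cong {x} {y} {u} {v} (congruent p) (congruent q) =
      by (∣m∣n⇒∣m+n (∣n⇒∣m*n u p) (∣n⇒∣m*n y q)) (eq x y u v)
      where
      eq : ∀ x y u v → u * (x - y) + y * (u - v) ≡ x * u - y * v
      eq = solve-∀

    neg-cong : ∀ {x y} → x ≡ y [mod n ] → - x ≡ - y [mod n ]
    neg-cong {x} {y} (congruent p) = by (∣m⇒∣-m p) (eq x y)
      where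
      eq : ∀ x y → - (x - y) ≡ - x - - y
      eq = solve-∀

ℤ/ : ℕ → CommutativeRing 0ℓ 0ℓ
ℤ/ n = record
  { Carrier = ℤ
  ; _≈_     = _≡_[mod n ]
  ; _+_     = _+_
  ; _*_     = _*_
  ; -_      = -_
  ; 0#      = 0ℤ
  ; 1#      = 1ℤ
  ; isCommutativeRing = record
    { isRing = record
      { +-isAbelianGroup = record
        { isGroup = record
          { isMonoid = record
            { isSemigroup = record
              { isMagma = record
                { isEquivalence = record
                  { refl = reflexive refl ; sym = symmetric ; trans = transitive }
                ; ∙-cong = +-cong
                }
              ; assoc = λ x y z → reflexive (ℤ.+-assoc x y z)
              }
            ; identity = (λ x → reflexive (ℤ.+-identityˡ x))
                       , (λ x → reflexive (ℤ.+-identityʳ x))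
            }
          ; inverse = (λ x → reflexive (ℤ.+-inverseˡ x))
                    , (λ x → reflexive (ℤ.+-inverseʳ x))
          ; ⁻¹-cong = neg-cong
          }
        ; comm = λ x y → reflexive (ℤ.+-comm x y)
        }
      ; *-cong     = *-cong
      ; *-assoc    = λ x y z → reflexive (ℤ.*-assoc x y z)
      ; *-identity = (λ x → reflexive (ℤ.*-identityˡ x))
                   , (λ x → reflexive (ℤ.*-identityʳ x))
      ; distrib    = (λ x y z → reflexive (ℤ.*-distribˡ-+ x y z))
                   , (λ x y z → reflexive (ℤ.*-distribʳ-+ x y z))
      }
    ; *-comm = λ x y → reflexive (ℤ.*-comm x y)
    }
  }
  where open Mod n

-- Simple undirected graphs.  Vertices form a setoid, and "distinct" always
-- means distinct up to _≈_.
record Graph : Set₁ where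
  infix 4 _~_
  field
    vertexSetoid : Setoid 0ℓ 0ℓ
  open Setoid vertexSetoid public using (_≈_) renaming (Carrier to Vertex)
  field
    _~_      : Rel Vertex 0ℓ
    ~-resp-≈ : _~_ Respects₂ _≈_
    ~-sym    : Symmetric _~_
    ~-irrefl : Irreflexive _≈_ _~_

module _ (R : CommutativeRing 0ℓ 0ℓ) where
  private
    module R = CommutativeRing R

  IsNonzeroZeroDivisor : R.Carrier → Set
  IsNonzeroZeroDivisor x =
    ¬ (x R.≈ R.0#) × ∃[ y ] (¬ (y R.≈ R.0#) × x R.* y R.≈ R.0#)

  zeroDivisorGraph : Graph
  zeroDivisorGraph = record
    { vertexSetoid = On.setoid R.setoid (proj₁ {B = IsNonzeroZeroDivisor})
    ; _~_          = λ (x , _) (y , _) → ¬ (x R.≈ y) × x R.* y R.≈ R.0#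
    ; ~-resp-≈     =
        (λ y≈y′ (x≉y , xy≈0) →
            (λ x≈y′ → x≉y (R.trans x≈y′ (R.sym y≈y′)))
          , R.trans (R.*-cong R.refl (R.sym y≈y′)) xy≈0)
      , (λ x≈x′ (x≉y , xy≈0) →
            (λ x′≈y → x≉y (R.trans x≈x′ x′≈y))
          , R.trans (R.*-cong (R.sym x≈x′) R.refl) xy≈0)
    ; ~-sym        = λ (x≉y , xy≈0) →
        (λ y≈x → x≉y (R.sym y≈x)) , R.trans (R.*-comm _ _) xy≈0
    ; ~-irrefl     = λ x≈y (x≉y , _) → x≉y x≈y
    }

module _ (G : Graph) where
  open Graph G
  private
    module V = Setoid vertexSetoid

  -- An edge is presented by an ordering of its end points; _≈ₑ_ identifies
  -- the two orderings.
  record Edge : Set where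
    constructor edge
    field
      {end₁ end₂} : Vertex
      adjacent    : end₁ ~ end₂

  open Edge

  infix 4 _∈ₑ_ _≈ₑ_

  _∈ₑ_ : Vertex → Edge → Set
  v ∈ₑ e = v ≈ end₁ e ⊎ v ≈ end₂ e

  data _≈ₑ_ (e f : Edge) : Set where
    same    : end₁ e ≈ end₁ f → end₂ e ≈ end₂ f → e ≈ₑ f
    swapped : end₁ e ≈ end₂ f → end₂ e ≈ end₁ f → e ≈ₑ f

  private
    ≈ₑ-sym : Symmetric _≈ₑ_
    ≈ₑ-sym (same p q) = same (V.sym p) (V.sym q)
    ≈ₑ-sym (swapped p q) = swapped (V.sym q) (V.sym p)

    ≈ₑ-trans : ∀ {e f g} → e ≈ₑ f → f ≈ₑ g → e ≈ₑ g
    ≈ₑ-trans (same p q) (same r s) = same (V.trans p r) (V.trans q s)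
    ≈ₑ-trans (same p q) (swapped r s) = swapped (V.trans p r) (V.trans q s)
    ≈ₑ-trans (swapped p q) (same r s) = swapped (V.trans p s) (V.trans q r)
    ≈ₑ-trans (swapped p q) (swapped r s) = same (V.trans p s) (V.trans q r)

    ∈ₑ-resp : ∀ {v e f} → e ≈ₑ f → v ∈ₑ e → v ∈ₑ f
    ∈ₑ-resp (same p q) (inj₁ r) = inj₁ (V.trans r p)
    ∈ₑ-resp (same p q) (inj₂ r) = inj₂ (V.trans r q)
    ∈ₑ-resp (swapped p q) (inj₁ r) = inj₂ (V.trans r p)
    ∈ₑ-resp (swapped p q) (inj₂ r) = inj₁ (V.trans r q)

  lineGraph : Graph
  lineGraph = record
    { vertexSetoid = record
      { Carrier       = Edge
      ; _≈_           = _≈ₑ_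
      ; isEquivalence = record
        { refl  = same V.refl V.refl
        ; sym   = ≈ₑ-sym
        ; trans = ≈ₑ-trans
        }
      }
    ; _~_          = λ e f → ¬ (e ≈ₑ f) × ∃[ v ] (v ∈ₑ e × v ∈ₑ f)
    ; ~-resp-≈     =
        (λ f≈f′ (e≉f , v , v∈e , v∈f) →
            (λ e≈f′ → e≉f (≈ₑ-trans e≈f′ (≈ₑ-sym f≈f′)))
          , v , v∈e , ∈ₑ-resp f≈f′ v∈f)
      , (λ e≈e′ (e≉f , v , v∈e , v∈f) →
            (λ e′≈f → e≉f (≈ₑ-trans e≈e′ e′≈f))
          , v , ∈ₑ-resp e≈e′ v∈e , v∈f)
    ; ~-sym        = λ (e≉f , v , v∈e , v∈f) →
        (λ f≈e → e≉f (≈ₑ-sym f≈e)) , v , v∈f , v∈e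
    ; ~-irrefl     = λ e≈f (e≉f , _) → e≉f e≈f
    }

module _ (G : Graph) where
  open Graph G

  data Walk : Vertex → Vertex → Set where
    stop : ∀ {x y} → x ≈ y → Walk x y
    step : ∀ {x y z} → x ~ y → Walk y z → Walk x z

  length : ∀ {x y} → Walk x y → ℕ
  length (stop _)   = zero
  length (step _ w) = suc (length w)

  visited : ∀ {x y} → Walk x y → List Vertex
  visited {x} (stop _)   = [ x ]
  visited {x} (step _ w) = x ∷ visited w

  IsPath : ∀ {x y} → Walk x y → Set
  IsPath w = Unique.Unique vertexSetoid (visited w)

  IsDistance : Vertex → Vertex → ℕ → Set
  IsDistance x y k =
      (Σ[ w ∈ Walk x y ] IsPath w × length w ≡ k)
    × ((w : Walk x y) → IsPath w → k ℕ.≤ length w)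

  -- "G is finite and connected, and W(G) = q": vertices lists every vertex
  -- exactly once, and the distance function d is total because any two
  -- vertices are joined by a path.  Such q is unique, as d is determined
  -- by G and vertices is determined up to order and _≈_.
  record HasWienerIndex (q : ℚ) : Set where
    field
      vertices   : List Vertex
      complete   : Enumerates.IsEnumeration vertexSetoid vertices
      unique     : Unique.Unique vertexSetoid vertices
      d          : Vertex → Vertex → ℕ
      isDistance : ∀ x y → IsDistance x y (d x y)
      formula    : q ≡ ½ ℚ.* (+ sum (cartesianProductWith d vertices vertices) / 1)

{-# OPTIONS --safe #-}

-- The nonzero zero divisors of ℤ/p² are the multiples k p with 0 < k < p, and
-- any two of them multiply to zero, so the zero-divisor graph is complete on
-- n = p - 1 vertices.  In the line graph of a complete graph,
-- d(e, f) = 2 - |e ∩ f|.  Summing |e ∩ f| over all f adds the degrees n - 1 of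
-- the two ends of e, so with l = n (n - 1) / 2 edges the distances from e sum
-- to 2 l - 2 (n - 1), and all distances sum to l (n - 1) (n - 2).

module Submission where

open import Defs
open import Algebra.Bundles using (CommutativeRing)
open import Data.Bool.Base using (if_then_else_)
open import Data.Fin.Base using (Fin; toℕ; fromℕ<)
open import Data.Fin.Properties using (toℕ<n; toℕ-injective; toℕ-fromℕ<)
open import Data.Integer.Base using (+_; _-_; _*_; _^_)
import Data.Integer.Base as ℤ
open import Data.Integer.Divisibility.Signed
open import Data.Integer.DivMod using (_%ℕ_; _/ℕ_; n%ℕd<d; a≡a%ℕn+[a/ℕn]*n)
import Data.Integer.Properties as ℤ
import Data.Integer.Tactic.RingSolver as ℤSolver
open import Data.List.Base as List using (List; []; _∷_; _++_; cartesianProductWith)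
open import Data.List.Properties using (length-++; length-tabulate; map-++)
open import Data.List.Relation.Unary.All as All using (All; []; _∷_)
import Data.List.Relation.Unary.All.Properties as All
open import Data.List.Relation.Unary.AllPairs using ([]; _∷_)
import Data.List.Relation.Unary.AllPairs.Properties as AllPairs
open import Data.List.Relation.Unary.Any as Any using (Any; here; there)
import Data.List.Relation.Unary.Any.Properties as Any
import Data.List.Relation.Unary.Enumerates.Setoid as Enumerates
import Data.List.Relation.Unary.Unique.Setoid as Unique
import Data.List.Relation.Unary.Unique.Setoid.Properties as Unique
open import Data.Nat.Base as ℕ using (ℕ; suc; _+_; _∸_; _≥_; z≤n; s≤s)
import Data.Nat.Divisibility as ℕ
open import Data.Nat.ListAction using (sum)
open import Data.Nat.ListAction.Properties using (sum-++)
open import Data.Nat.Primality using (Prime; euclidsLemma; prime⇒nonTrivial; prime⇒nonZero)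
import Data.Nat.Properties as ℕ
import Data.Nat.Tactic.RingSolver as ℕSolver
open import Data.Product.Base using (_,_; proj₁)
open import Data.Rational.Base as ℚ using (½; _/_; toℚᵘ)
import Data.Rational.Properties as ℚ
open import Data.Rational.Unnormalised.Base as ℚᵘ using (mkℚᵘ; *≡*)
import Data.Rational.Unnormalised.Properties as ℚᵘ
open import Data.Sum.Base as Sum using (_⊎_; inj₁; inj₂)
open import Function.Base using (_∘_)
open import Relation.Binary.Bundles using (Setoid)
open import Relation.Binary.Definitions using (Decidable)
open import Relation.Binary.PropositionalEquality
open import Relation.Nullary.Decidable.Core using (does; yes; no; map′)
open import Relation.Nullary.Negation.Core using (¬_; contradiction)

-- Lists built by `All.reduce`, and sums over lists.

module _ {A B : Set} {P : A → Set} {f : ∀ {x} → P x → B} where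

  All-reduce⁺ : ∀ {Q : B → Set} {xs} → All (λ x → (px : P x) → Q (f px)) xs →
                (pxs : All P xs) → All Q (All.reduce f pxs)
  All-reduce⁺ []       []         = []
  All-reduce⁺ (q ∷ qs) (px ∷ pxs) = q px ∷ All-reduce⁺ qs pxs

  Any-reduce⁺ : ∀ {Q : B → Set} {xs} → Any (λ x → (px : P x) → Q (f px)) xs →
                (pxs : All P xs) → Any Q (All.reduce f pxs)
  Any-reduce⁺ (here q)  (px ∷ pxs) = here (q px)
  Any-reduce⁺ (there i) (px ∷ pxs) = there (Any-reduce⁺ i pxs)

  length-reduce : ∀ {xs} (pxs : All P xs) → List.length (All.reduce f pxs) ≡ List.length xs
  length-reduce []         = refl
  length-reduce (px ∷ pxs) = cong suc (length-reduce pxs)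

sum-map-++ : ∀ {A : Set} (f : A → ℕ) xs ys →
             sum (List.map f (xs ++ ys)) ≡ sum (List.map f xs) + sum (List.map f ys)
sum-map-++ f xs ys = trans (cong sum (map-++ f xs ys)) (sum-++ (List.map f xs) (List.map f ys))

sum-map-complement : ∀ {A : Set} {f g h : A → ℕ} {c} → (∀ x → f x + (g x + h x) ≡ c) → ∀ xs →
  sum (List.map f xs) + (sum (List.map g xs) + sum (List.map h xs)) ≡ List.length xs ℕ.* c
sum-map-complement         eq []       = refl
sum-map-complement {f = f} {g} {h} eq (x ∷ xs) =
  trans (shuffle (f x) _ (g x) _ (h x) _) (cong₂ _+_ (eq x) (sum-map-complement eq xs))
  where
  shuffle : ∀ a a′ b b′ c c′ →
            a + a′ + (b + b′ + (c + c′)) ≡ a + (b + c) + (a′ + (b′ + c′))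
  shuffle = ℕSolver.solve-∀

-- Each row sums to `l - k`; `k` is kept on the left so that everything stays in `ℕ`.
sum-cartesianProductWith : ∀ {A B : Set} {f : A → B → ℕ} {ys k l} →
  (∀ x → sum (List.map (f x) ys) + k ≡ l) → ∀ xs →
  sum (cartesianProductWith f xs ys) + List.length xs ℕ.* k ≡ List.length xs ℕ.* l
sum-cartesianProductWith                eq []       = refl
sum-cartesianProductWith {f = f} {ys} {k} eq (x ∷ xs) = trans
  (cong (_+ (k + List.length xs ℕ.* k)) (sum-++ (List.map (f x) ys) (cartesianProductWith f xs ys)))
  (trans (shuffle (sum (List.map (f x) ys)) _ k _)
         (cong₂ _+_ (eq x) (sum-cartesianProductWith eq xs)))
  where
  shuffle : ∀ a b c d → a + b + (c + d) ≡ a + c + (b + d)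
  shuffle = ℕSolver.solve-∀

half-of-quarter : ∀ {s x} → + 2 * s ≡ x → x / 4 ≡ ½ ℚ.* (s / 1)
half-of-quarter {s} {x} eq = ℚ.toℚᵘ-injective (begin
  -- The second argument of `mkℚᵘ` is the denominator minus one. Passing to unnormalised rationals
  -- leaves a cross-multiplication.
  toℚᵘ (x / 4)             ≈⟨ ℚ.toℚᵘ-fromℚᵘ (mkℚᵘ x 3) ⟩
  mkℚᵘ x 3                 ≈⟨ *≡* (trans (cong (_* + 2) (sym eq)) (shuffle s)) ⟩
  ℚᵘ.½ ℚᵘ.* mkℚᵘ s 0       ≈⟨ ℚᵘ.*-congˡ {ℚᵘ.½} (ℚ.toℚᵘ-fromℚᵘ (mkℚᵘ s 0)) ⟨
  toℚᵘ ½ ℚᵘ.* toℚᵘ (s / 1) ≈⟨ ℚ.toℚᵘ-homo-* ½ (s / 1) ⟨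
  toℚᵘ (½ ℚ.* (s / 1))     ∎)
  where
  open ℚᵘ.≃-Reasoning
  shuffle : ∀ s → + 2 * s * + 2 ≡ + 1 * s * + 4
  shuffle = ℤSolver.solve-∀

-- Enumerating the edges of a complete graph.

module LineGraphOfComplete
  (G : Graph)
  (_≟_      : Decidable (Graph._≈_ G))
  (complete : ∀ x y → ¬ Graph._≈_ G x y → Graph._~_ G x y)
  where

  open Graph G
  private
    module V = Setoid vertexSetoid
    L = lineGraph G
    module L = Graph L
    module E = Setoid L.vertexSetoid
    open Edge

  ends-distinct : (e : Edge G) → ¬ end₁ e ≈ end₂ e
  ends-distinct e p = ~-irrefl p (adjacent e)

  star : ∀ {x ys} → All (λ y → ¬ x ≈ y) ys → List (Edge G)
  star = All.reduce (edge ∘ complete _ _)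

  -- Recursion is on the uniqueness proof, because its inequalities are what `complete` turns into
  -- edges. Each edge arises in the star of whichever end is listed first.
  edges : ∀ {xs} → Unique.Unique vertexSetoid xs → List (Edge G)
  edges []       = []
  edges (p ∷ u)  = star p ++ edges u

  star-unique : ∀ {x ys} (p : All (λ y → ¬ x ≈ y) ys) → Unique.Unique vertexSetoid ys →
                Unique.Unique L.vertexSetoid (star p)
  star-unique []      []      = []
  star-unique (_ ∷ p) (q ∷ u) =
    All-reduce⁺ (All.map (λ y≉z x≉z → λ
      { (same _ y≈z) → y≉z y≈z ; (swapped x≈z _) → x≉z x≈z }) q) p
    ∷ star-unique p u

  -- Keeps the star of `x` disjoint from the edges among the later vertices.
  edges-avoid : ∀ {x ys} → All (λ y → ¬ x ≈ y) ys → (u : Unique.Unique vertexSetoid ys) →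
                All (λ e → ¬ _∈ₑ_ G x e) (edges u)
  edges-avoid []        []      = []
  edges-avoid (x≉y ∷ p) (q ∷ u) = All.++⁺
    (All-reduce⁺ (All.map (λ x≉z _ → λ { (inj₁ x≈y) → x≉y x≈y ; (inj₂ x≈z) → x≉z x≈z }) p) q)
    (edges-avoid p u)

  edges-unique : ∀ {xs} (u : Unique.Unique vertexSetoid xs) →
                 Unique.Unique L.vertexSetoid (edges u)
  edges-unique []      = []
  edges-unique (p ∷ u) = AllPairs.++⁺ (star-unique p u) (edges-unique u)
    (All-reduce⁺ (All.universal (λ _ _ → All.map (λ x∉f → λ
      { (same q _) → x∉f (inj₁ q) ; (swapped q _) → x∉f (inj₂ q) }) (edges-avoid p u)) _) p)

  -- An end found at the head puts `e` in the star of the head, as it stands or swapped. Both ends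
  -- cannot be there, as they are distinct.
  edges-complete : ∀ {xs} (u : Unique.Unique vertexSetoid xs) (e : Edge G) →
                   Any (end₁ e ≈_) xs → Any (end₂ e ≈_) xs → Any (e L.≈_) (edges u)
  edges-complete (p ∷ u) e (here a≈x) (here b≈x) =
    contradiction (V.trans a≈x (V.sym b≈x)) (ends-distinct e)
  edges-complete (p ∷ u) e (here a≈x) (there j)  =
    Any.++⁺ˡ (Any-reduce⁺ (Any.map (λ b≈y _ → same a≈x b≈y) j) p)
  edges-complete (p ∷ u) e (there i)  (here b≈x) =
    Any.++⁺ˡ (Any-reduce⁺ (Any.map (λ a≈y _ → swapped a≈y b≈x) i) p)
  edges-complete (p ∷ u) e (there i)  (there j)  = Any.++⁺ʳ _ (edges-complete u e i j)

  -- The count `n (n - 1) / 2`, cleared of division and subtraction. A new vertex adds a star of `n`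
  -- edges, which matches the growth from `n²` to `(n + 1)²`.
  length-edges : ∀ {xs} (u : Unique.Unique vertexSetoid xs) →
    List.length (edges u) ℕ.* 2 + List.length xs ≡ List.length xs ℕ.* List.length xs
  length-edges []               = refl
  length-edges {_ ∷ xs} (p ∷ u) = begin
    List.length (star p ++ edges u) ℕ.* 2 + suc n
      ≡⟨ cong (λ l → l ℕ.* 2 + suc n)
           (trans (length-++ (star p)) (cong (_+ List.length (edges u)) (length-reduce p))) ⟩
    (n + List.length (edges u)) ℕ.* 2 + suc n
      ≡⟨ shuffle n _ ⟩
    1 + 2 ℕ.* n + (List.length (edges u) ℕ.* 2 + n)
      ≡⟨ cong (λ z → 1 + 2 ℕ.* n + z) (length-edges u) ⟩
    1 + 2 ℕ.* n + n ℕ.* n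
      ≡⟨ square n ⟩
    suc n ℕ.* suc n ∎
    where
    open ≡-Reasoning
    n = List.length xs
    shuffle : ∀ n l → (n + l) ℕ.* 2 + suc n ≡ 1 + 2 ℕ.* n + (l ℕ.* 2 + n)
    shuffle = ℕSolver.solve-∀
    square : ∀ n → 1 + 2 ℕ.* n + n ℕ.* n ≡ suc n ℕ.* suc n
    square = ℕSolver.solve-∀

  -- Vertex degrees by double counting.

  δ : Vertex → Vertex → ℕ
  δ x y = if does (x ≟ y) then 1 else 0

  -- At most 1, because the ends of an edge are distinct.
  incidence : Vertex → Edge G → ℕ
  incidence v e = δ v (end₁ e) + δ v (end₂ e)

  count : Vertex → List Vertex → ℕ
  count v xs = sum (List.map (δ v) xs)

  degree : Vertex → List (Edge G) → ℕ
  degree v es = sum (List.map (incidence v) es)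

  -- Every edge of the star has `x` as one end, while the other end runs through `ys`.
  degree-star : ∀ v {x ys} (p : All (λ y → ¬ x ≈ y) ys) →
                degree v (star p) ≡ List.length ys ℕ.* δ v x + count v ys
  degree-star v             []      = refl
  degree-star v {x} {y ∷ ys} (_ ∷ p) =
    trans (cong (λ z → δ v x + δ v y + z) (degree-star v p)) (shuffle (δ v x) (δ v y) _ _)
    where
    shuffle : ∀ a b c d → a + b + (c + d) ≡ a + c + (b + d)
    shuffle = ℕSolver.solve-∀

  -- The factor count v xs makes the identity inductive over xs, whose
  -- tails may not contain v.
  degree-edges : ∀ v {xs} (u : Unique.Unique vertexSetoid xs) →
                 degree v (edges u) + count v xs ≡ count v xs ℕ.* List.length xs
  degree-edges v               []      = refl
  degree-edges v {x ∷ xs} (p ∷ u) = begin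
    degree v (star p ++ edges u) + (δ v x + c)
      ≡⟨ cong (_+ (δ v x + c)) (trans (sum-map-++ (incidence v) (star p) (edges u))
           (cong (_+ degree v (edges u)) (degree-star v p))) ⟩
    n ℕ.* δ v x + c + degree v (edges u) + (δ v x + c)
      ≡⟨ shuffle n (δ v x) c _ ⟩
    n ℕ.* δ v x + c + δ v x + (degree v (edges u) + c)
      ≡⟨ cong (λ z → n ℕ.* δ v x + c + δ v x + z) (degree-edges v u) ⟩
    n ℕ.* δ v x + c + δ v x + c ℕ.* n
      ≡⟨ expand n (δ v x) c ⟩
    (δ v x + c) ℕ.* suc n ∎
    where
    open ≡-Reasoning
    n = List.length xs
    c = count v xs
    shuffle : ∀ n a c d → n ℕ.* a + c + d + (a + c) ≡ n ℕ.* a + c + a + (d + c)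
    shuffle = ℕSolver.solve-∀
    expand : ∀ n a c → n ℕ.* a + c + a + c ℕ.* n ≡ (a + c) ℕ.* suc n
    expand = ℕSolver.solve-∀

  count-absent : ∀ {v xs} → All (λ x → ¬ v ≈ x) xs → count v xs ≡ 0
  count-absent []                          = refl
  count-absent {v} {x ∷ _} (v≉x ∷ p) with v ≟ x
  ... | yes v≈x = contradiction v≈x v≉x
  ... | no  _   = count-absent p

  count-unique : ∀ {v xs} → Unique.Unique vertexSetoid xs → Any (v ≈_) xs → count v xs ≡ 1
  count-unique {v} {x ∷ _} (p ∷ u) i with v ≟ x
  count-unique (p ∷ u) i           | yes v≈x =
    cong suc (count-absent (All.map (λ x≉y v≈y → x≉y (V.trans (V.sym v≈x) v≈y)) p))
  count-unique (p ∷ u) (here v≈x)  | no v≉x  = contradiction v≈x v≉x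
  count-unique (p ∷ u) (there i)   | no _    = count-unique u i

  -- Distances in the line graph.

  shared : Edge G → Edge G → ℕ
  shared e f = incidence (end₁ e) f + incidence (end₂ e) f

  -- The index is the number of common vertices, so matching on a position also evaluates
  -- `distance`.
  data Position (e f : Edge G) : ℕ → Set where
    equal : e L.≈ f → Position e f 2
    meet  : e L.~ f → Position e f 1
    apart : (∀ {v} → _∈ₑ_ G v e → ¬ _∈ₑ_ G v f) → Position e f 0

  -- The first four clauses discard the outcomes in which one vertex would equal both ends of an
  -- edge. Seven of the sixteen outcomes remain.
  position : ∀ e f → Position e f (shared e f)
  position e f with end₁ e ≟ end₁ f | end₁ e ≟ end₂ f | end₂ e ≟ end₁ f | end₂ e ≟ end₂ f
  ... | yes ac | yes ad | _      | _      = contradiction (V.trans (V.sym ac) ad) (ends-distinct f)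
  ... | _      | _      | yes bc | yes bd = contradiction (V.trans (V.sym bc) bd) (ends-distinct f)
  ... | yes ac | _      | yes bc | _      = contradiction (V.trans ac (V.sym bc)) (ends-distinct e)
  ... | _      | yes ad | _      | yes bd = contradiction (V.trans ad (V.sym bd)) (ends-distinct e)
  ... | yes ac | no _   | no _   | yes bd = equal (same ac bd)
  ... | no _   | yes ad | yes bc | no _   = equal (swapped ad bc)
  ... | yes ac | no ¬ad | no _   | no ¬bd =
    meet ((λ { (same _ q) → ¬bd q ; (swapped q _) → ¬ad q }) , _ , inj₁ V.refl , inj₁ ac)
  ... | no ¬ac | yes ad | no ¬bc | no _   =
    meet ((λ { (same q _) → ¬ac q ; (swapped _ q) → ¬bc q }) , _ , inj₁ V.refl , inj₂ ad)
  ... | no ¬ac | no ¬ad | yes bc | no _   =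
    meet ((λ { (same q _) → ¬ac q ; (swapped q _) → ¬ad q }) , _ , inj₂ V.refl , inj₁ bc)
  ... | no ¬ac | no ¬ad | no _   | yes bd =
    meet ((λ { (same q _) → ¬ac q ; (swapped q _) → ¬ad q }) , _ , inj₂ V.refl , inj₂ bd)
  ... | no ¬ac | no ¬ad | no ¬bc | no ¬bd = apart λ
    { (inj₁ va) (inj₁ vc) → ¬ac (V.trans (V.sym va) vc)
    ; (inj₁ va) (inj₂ vd) → ¬ad (V.trans (V.sym va) vd)
    ; (inj₂ vb) (inj₁ vc) → ¬bc (V.trans (V.sym vb) vc)
    ; (inj₂ vb) (inj₂ vd) → ¬bd (V.trans (V.sym vb) vd)
    }

  distance : Edge G → Edge G → ℕ
  distance e f = 2 ∸ shared e f

  -- The truncated subtraction in `distance` is exact, since two edges share at most two ends.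
  distance+shared : ∀ e f → distance e f + shared e f ≡ 2
  distance+shared e f with shared e f | position e f
  ... | _ | equal _ = refl
  ... | _ | meet  _ = refl
  ... | _ | apart _ = refl

  isDistance : ∀ e f → IsDistance L e f (distance e f)
  isDistance e f with shared e f | position e f
  ... | _ | equal e≈f = (stop e≈f , [] ∷ [] , refl) , λ _ _ → z≤n
  ... | _ | meet e~f@(e≉f , _) =
    (step {y = f} e~f (stop E.refl) , (e≉f ∷ []) ∷ [] ∷ [] , refl) , λ
      { (stop e≈f) _ → contradiction e≈f e≉f
      ; (step _ _) _ → s≤s z≤n
      }
  ... | _ | apart e#f =
    ( step {y = g} e~g (step {y = f} g~f (stop E.refl))
    , (proj₁ e~g ∷ e≉f ∷ []) ∷ (proj₁ g~f ∷ []) ∷ [] ∷ []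
    , refl ) , λ
      { (stop e≈f) _ → contradiction e≈f e≉f
      -- A walk of length one would put a vertex of `e` on `h`, hence on `f`, although `e` and `f`
      -- are disjoint.
      ; (step (_ , _ , v∈e , v∈h) (stop h≈f)) _ → contradiction (transport h≈f v∈h) (e#f v∈e)
      ; (step _ (step _ _)) _ → s≤s (s≤s z≤n)
      }
    where
    a∈e : _∈ₑ_ G (end₁ e) e
    a∈e = inj₁ V.refl
    c∈f : _∈ₑ_ G (end₁ f) f
    c∈f = inj₁ V.refl
    transport : ∀ {v h k} → h L.≈ k → _∈ₑ_ G v h → _∈ₑ_ G v k
    transport (same p q)    (inj₁ r) = inj₁ (V.trans r p)
    transport (same p q)    (inj₂ r) = inj₂ (V.trans r q)
    transport (swapped p q) (inj₁ r) = inj₂ (V.trans r p)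
    transport (swapped p q) (inj₂ r) = inj₁ (V.trans r q)
    e≉f : ¬ e L.≈ f
    e≉f e≈f = e#f a∈e (transport e≈f a∈e)
    -- The midpoint of a path of length two: completeness joins an end of `e` to an end of `f`.
    g : Edge G
    g = edge (complete (end₁ e) (end₁ f) (λ a≈c → e#f a∈e (inj₁ a≈c)))
    e~g : e L.~ g
    e~g = (λ e≈g → e#f (transport (E.sym e≈g) (inj₂ V.refl)) c∈f) , _ , a∈e , inj₁ V.refl
    g~f : g L.~ f
    g~f = (λ g≈f → e#f a∈e (transport g≈f (inj₁ V.refl))) , _ , inj₂ V.refl , c∈f

  -- Summing all distances.

  module _ {vs} (enum : Enumerates.IsEnumeration vertexSetoid vs)
                (uniq : Unique.Unique vertexSetoid vs) where

    private
      n = List.length vs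
      es = edges uniq
      l = List.length es
      S = sum (cartesianProductWith distance es es)

    -- The vertex `v` occurs exactly once in `vs`, so the factor `count v vs` in `degree-edges` is
    -- 1.
    degree+1 : ∀ v → degree v es + 1 ≡ n
    degree+1 v with count v vs | count-unique uniq (enum v) | degree-edges v uniq
    ... | _ | refl | eq = trans eq (ℕ.+-identityʳ n)

    -- Summing `distance+shared` over all edges turns the shared ends into the degrees of the two
    -- ends of `e`, each `n - 1`.
    sum-distances-from : ∀ e → sum (List.map (distance e) es) + 2 ℕ.* n ≡ l ℕ.* 2 + 2
    sum-distances-from e = begin
      s + 2 ℕ.* n                   ≡⟨ cong (λ m → s + (n + m)) (ℕ.+-identityʳ n) ⟩
      s + (n + n)                   ≡⟨ cong (λ z → s + z) (cong₂ _+_ (degree+1 a) (degree+1 b)) ⟨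
      s + (degree a es + 1 + (degree b es + 1)) ≡⟨ shuffle s (degree a es) (degree b es) ⟩
      s + (degree a es + degree b es) + 2
        ≡⟨ cong (_+ 2) (sum-map-complement (distance+shared e) es) ⟩
      l ℕ.* 2 + 2 ∎
      where
      open ≡-Reasoning
      a = end₁ e
      b = end₂ e
      s = sum (List.map (distance e) es)
      shuffle : ∀ s x y → s + (x + 1 + (y + 1)) ≡ s + (x + y) + 2
      shuffle = ℕSolver.solve-∀

    sum-distances : + 2 * + S ≡ + n * (+ n - + 1) ^ 2 * (+ n - + 2)
    sum-distances = begin
      + 2 * + S
        -- The form `l * 2 + n - n` stands for `2 l`, so that `size` can later replace `l * 2 + n`
        -- by `n * n`.
        ≡⟨ regroup (+ S) (+ l) (+ n) ⟩
      + 2 * (+ S ℤ.+ + l * (+ 2 * + n)) - (+ l * + 2 ℤ.+ + n - + n) * (+ 2 * + n)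
        ≡⟨ cong (λ z → + 2 * z - (+ l * + 2 ℤ.+ + n - + n) * (+ 2 * + n)) total ⟩
      + 2 * (+ l * (+ l * + 2 ℤ.+ + 2)) - (+ l * + 2 ℤ.+ + n - + n) * (+ 2 * + n)
        ≡⟨ factor (+ l) (+ n) ⟩
      (+ l * + 2 ℤ.+ + n - + n) * (+ l * + 2 ℤ.+ + n - + n ℤ.+ + 2 - + 2 * + n)
        ≡⟨ cong (λ z → (z - + n) * (z - + n ℤ.+ + 2 - + 2 * + n)) size ⟩
      (+ n * + n - + n) * (+ n * + n - + n ℤ.+ + 2 - + 2 * + n)
        ≡⟨ refactor (+ n) ⟩
      + n * (+ n - + 1) ^ 2 * (+ n - + 2) ∎
      where
      open ≡-Reasoning
      total : + S ℤ.+ + l * (+ 2 * + n) ≡ + l * (+ l * + 2 ℤ.+ + 2)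
      total = begin
        + S ℤ.+ + l * (+ 2 * + n)
          ≡⟨ cong (λ z → + S ℤ.+ z) (trans (ℤ.pos-* l _) (cong (+ l *_) (ℤ.pos-* 2 n))) ⟨
        + (S ℕ.+ l ℕ.* (2 ℕ.* n))
          ≡⟨ cong +_ (sum-cartesianProductWith sum-distances-from es) ⟩
        + (l ℕ.* (l ℕ.* 2 ℕ.+ 2))
          ≡⟨ trans (ℤ.pos-* l _) (cong (λ z → + l * (z ℤ.+ + 2)) (ℤ.pos-* l 2)) ⟩
        + l * (+ l * + 2 ℤ.+ + 2) ∎
      size : + l * + 2 ℤ.+ + n ≡ + n * + n
      size = begin
        + l * + 2 ℤ.+ + n   ≡⟨ cong (ℤ._+ + n) (ℤ.pos-* l 2) ⟨
        + (l ℕ.* 2 ℕ.+ n)   ≡⟨ cong +_ (length-edges uniq) ⟩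
        + (n ℕ.* n)         ≡⟨ ℤ.pos-* n n ⟩
        + n * + n           ∎
      regroup : ∀ s l n →
        + 2 * s ≡ + 2 * (s ℤ.+ l * (+ 2 * n)) - (l * + 2 ℤ.+ n - n) * (+ 2 * n)
      regroup = ℤSolver.solve-∀
      factor : ∀ l n →
        + 2 * (l * (l * + 2 ℤ.+ + 2)) - (l * + 2 ℤ.+ n - n) * (+ 2 * n) ≡
        (l * + 2 ℤ.+ n - n) * (l * + 2 ℤ.+ n - n ℤ.+ + 2 - + 2 * n)
      factor = ℤSolver.solve-∀
      -- The square is spelled out in the form to which `^ 2` unfolds.
      refactor : ∀ n → (n * n - n) * (n * n - n ℤ.+ + 2 - + 2 * n) ≡
        n * ((n - + 1) * ((n - + 1) * + 1)) * (n - + 2)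
      refactor = ℤSolver.solve-∀

    wienerIndex : HasWienerIndex L ((+ n * (+ n - + 1) ^ 2 * (+ n - + 2)) / 4)
    wienerIndex = record
      { vertices   = es
      ; complete   = λ e → edges-complete uniq e (enum _) (enum _)
      ; unique     = edges-unique uniq
      ; d          = distance
      ; isDistance = isDistance
      ; formula    = half-of-quarter {+ S} sum-distances
      }

-- Zero divisors modulo the square of a prime.

∣∧<⇒≡0 : ∀ {k i} → + k ∣ i → ℤ.∣ i ∣ ℕ.< k → i ≡ + 0
∣∧<⇒≡0 {k} {i} k∣i i<k with ℤ.∣ i ∣ in eq
... | 0     = ℤ.∣i∣≡0⇒i≡0 eq
... | suc _ = contradiction (subst (k ℕ.∣_) eq (∣⇒∣ᵤ k∣i)) (ℕ.>⇒∤ i<k)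

module ZeroDivisors (p : ℕ) (isPrime : Prime p) where

  private
    instance
      p≢0 : ℕ.NonZero p
      p≢0 = prime⇒nonZero isPrime
    P = + p
    G = zeroDivisorGraph (ℤ/ (p ℕ.^ 2))
    module R = CommutativeRing (ℤ/ (p ℕ.^ 2))
  open Graph G

  +p²≡P*P : + (p ℕ.^ 2) ≡ P * P
  +p²≡P*P = trans (cong (λ q → + (p ℕ.* q)) (ℕ.*-identityʳ p)) (ℤ.pos-* p p)

  ∣⇒≈ : ∀ {x y} → P * P ∣ x - y → x R.≈ y
  ∣⇒≈ {x} {y} d = congruent (subst (_∣ x - y) (sym +p²≡P*P) d)

  ≈⇒∣ : ∀ {x y} → x R.≈ y → P * P ∣ x - y
  ≈⇒∣ {x} {y} (congruent d) = subst (_∣ x - y) +p²≡P*P d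

  ∣⇒≈0 : ∀ {x} → P * P ∣ x → x R.≈ + 0
  ∣⇒≈0 {x} = ∣⇒≈ ∘ subst (P * P ∣_) (sym (ℤ.+-identityʳ x))

  ≈0⇒∣ : ∀ {x} → x R.≈ + 0 → P * P ∣ x
  ≈0⇒∣ {x} = subst (P * P ∣_) (ℤ.+-identityʳ x) ∘ ≈⇒∣

  _≈?_ : Decidable R._≈_
  x ≈? y = map′ ∣⇒≈ ≈⇒∣ (P * P ∣? x - y)

  euclid : ∀ {x y} → P ∣ x * y → P ∣ x ⊎ P ∣ y
  euclid {x} {y} d = Sum.map ∣ᵤ⇒∣ ∣ᵤ⇒∣
    (euclidsLemma ℤ.∣ x ∣ ℤ.∣ y ∣ isPrime (subst (p ℕ.∣_) (ℤ.abs-* x y) (∣⇒∣ᵤ d)))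

  -- If `p` divides the cofactor instead, write `y = k p`. Cancelling `p` leaves `p` dividing `x k`,
  -- and `p` dividing `k` would make `y` zero.
  zeroDivisor⇒∣ : ∀ {x} → IsNonzeroZeroDivisor (ℤ/ (p ℕ.^ 2)) x → P ∣ x
  zeroDivisor⇒∣ {x} (_ , y , y≉0 , xy≈0) with euclid {x} {y} (∣-trans (∣n⇒∣m*n P ∣-refl) (≈0⇒∣ xy≈0))
  ... | inj₁ P∣x              = P∣x
  ... | inj₂ (divides k refl) with euclid {x} {k}
    (*-cancelʳ-∣ P (subst (P * P ∣_) (sym (ℤ.*-assoc x k P)) (≈0⇒∣ xy≈0)))
  ...   | inj₁ P∣x = P∣x
  ...   | inj₂ P∣k = contradiction (∣⇒≈0 (*-monoˡ-∣ P P∣k)) y≉0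

  -- Both vertices are multiples of `p`, so their product is a multiple of `p²`.
  distinct⇒adjacent : ∀ x y → ¬ x ≈ y → x ~ y
  distinct⇒adjacent (_ , x-zd) (_ , y-zd) x≉y with zeroDivisor⇒∣ x-zd | zeroDivisor⇒∣ y-zd
  ... | divides a refl | divides b refl = x≉y , ∣⇒≈0 (divides (a * b) (eq a b P))
    where
    eq : ∀ a b c → (a * c) * (b * c) ≡ (a * b) * (c * c)
    eq = ℤSolver.solve-∀

  distrib : ∀ a b c → a * c - b * c ≡ (a - b) * c
  distrib = ℤSolver.solve-∀

  -- With `*P-cancel`, this reduces congruence of multiples of `p` modulo `p²` to congruence of
  -- their coefficients modulo `p`.
  *P-cong : ∀ {a b} → P ∣ a - b → a * P R.≈ b * P
  *P-cong {a} {b} d = ∣⇒≈ (subst (P * P ∣_) (sym (distrib a b P)) (*-monoˡ-∣ P d))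

  *P-cancel : ∀ {a b} → a * P R.≈ b * P → P ∣ a - b
  *P-cancel {a} {b} eq = *-cancelʳ-∣ P (subst (P * P ∣_) (distrib a b P) (≈⇒∣ eq))

  *P≉0 : ∀ {k} .{{_ : ℕ.NonZero k}} → k ℕ.< p → ¬ + k * P R.≈ + 0
  *P≉0 {k} k<p eq = ℕ.>⇒∤ k<p (∣⇒∣ᵤ (*-cancelʳ-∣ P {P} {+ k} (≈0⇒∣ eq)))

  1<p : 1 ℕ.< p
  1<p = ℕ.nonTrivial⇒n>1 p {{prime⇒nonTrivial isPrime}}

  -- The annihilating cofactor is `p` itself, nonzero because it is `1 p` with `1 < p`.
  multiple-isNonzeroZeroDivisor : ∀ k .{{_ : ℕ.NonZero k}} → k ℕ.< p →
                                  IsNonzeroZeroDivisor (ℤ/ (p ℕ.^ 2)) (+ k * P)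
  multiple-isNonzeroZeroDivisor k k<p =
      *P≉0 {k} k<p
    , P
    , (λ P≈0 → *P≉0 {1} 1<p (subst (R._≈ + 0) (sym (ℤ.*-identityˡ P)) P≈0))
    , ∣⇒≈0 (divides (+ k) (ℤ.*-assoc (+ k) P P))

  suc-toℕ<p : (i : Fin (ℕ.pred p)) → suc (toℕ i) ℕ.< p
  suc-toℕ<p i = subst (suc (suc (toℕ i)) ℕ.≤_) (ℕ.suc-pred p) (s≤s (toℕ<n i))

  -- The shift by one skips the coefficient 0 and leaves 1 to `p - 1`.
  multiple : Fin (ℕ.pred p) → Vertex
  multiple i = + suc (toℕ i) * P , multiple-isNonzeroZeroDivisor (suc (toℕ i)) (suc-toℕ<p i)

  -- The difference of the coefficients is divisible by `p` but smaller than `p` in absolute value.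
  <p-injective : ∀ {k l} → k ℕ.< p → l ℕ.< p → + k * P R.≈ + l * P → k ≡ l
  <p-injective {k} {l} k<p l<p eq = ℤ.+-injective (ℤ.i-j≡0⇒i≡j (+ k) (+ l)
    (∣∧<⇒≡0 (*P-cancel {+ k} {+ l} eq) (ℕ.≤-<-trans bound (ℕ.⊔-pres-<m k<p l<p))))
    where
    bound : ℤ.∣ + k - + l ∣ ℕ.≤ k ℕ.⊔ l
    bound = subst (λ d → ℤ.∣ d ∣ ℕ.≤ k ℕ.⊔ l) (sym (ℤ.m-n≡m⊖n k l)) (ℤ.∣m⊝n∣≤m⊔n k l)

  multiple-injective : ∀ {i j} → multiple i ≈ multiple j → i ≡ j
  multiple-injective {i} {j} eq =
    toℕ-injective (ℕ.suc-injective (<p-injective (suc-toℕ<p i) (suc-toℕ<p j) eq))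

  *P≈%*P : ∀ k → k * P R.≈ + (k %ℕ p) * P
  *P≈%*P k = *P-cong {k} {+ (k %ℕ p)} (divides (k /ℕ p)
    (trans (cong (_- + (k %ℕ p)) (a≡a%ℕn+[a/ℕn]*n k p)) (cancel (+ (k %ℕ p)) (k /ℕ p * P))))
    where
    cancel : ∀ a b → a ℤ.+ b - a ≡ b
    cancel = ℤSolver.solve-∀

  -- The class of `k p` depends only on the remainder of `k` modulo `p`. Remainder 0 would give the
  -- zero class; remainder `suc r` is found at index `r`.
  multiples-complete : Enumerates.IsEnumeration vertexSetoid (List.tabulate multiple)
  multiples-complete (x , x-zd@(x≉0 , _)) with zeroDivisor⇒∣ x-zd
  ... | divides k refl with k %ℕ p | n%ℕd<d k p | *P≈%*P k
  ...   | 0     | _   | x≈0  = contradiction x≈0 x≉0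
  ...   | suc r | r<p | x≈rP = Any.tabulate⁺ (fromℕ< (ℕ.<⇒≤pred r<p))
    (subst (λ t → k * P R.≈ + suc t * P) (sym (toℕ-fromℕ< (ℕ.<⇒≤pred r<p))) x≈rP)

theorem3p8 : (p : ℕ) → Prime p → p ≥ 5 →
    HasWienerIndex (lineGraph (zeroDivisorGraph (ℤ/ (p ℕ.^ 2))))
    (((+ p - + 1) * (+ p - + 2) ^ 2 * (+ p - + 3)) / 4)
theorem3p8 p isPrime _ =
  subst (λ x → HasWienerIndex (lineGraph Γ) (x / 4)) numerator
    (wienerIndex multiples-complete (Unique.tabulate⁺ (Graph.vertexSetoid Γ) multiple-injective))
  where
  open ZeroDivisors p isPrime
  Γ = zeroDivisorGraph (ℤ/ (p ℕ.^ 2))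
  open LineGraphOfComplete Γ (λ (x , _) (y , _) → x ≈? y) distinct⇒adjacent
  vs = List.tabulate multiple
  n = List.length vs
  suc-n≡p : suc n ≡ p
  suc-n≡p = trans (cong suc (length-tabulate multiple))
                  (ℕ.suc-pred p {{prime⇒nonZero isPrime}})
  -- Substituting `p = 1 + n` turns `n`, `n - 1`, `n - 2` into `p - 1`, `p - 2`, `p - 3`.
  shift : ∀ n → n * ((n - + 1) * ((n - + 1) * + 1)) * (n - + 2) ≡
    (+ 1 ℤ.+ n - + 1) * ((+ 1 ℤ.+ n - + 2) * ((+ 1 ℤ.+ n - + 2) * + 1)) * (+ 1 ℤ.+ n - + 3)
  shift = ℤSolver.solve-∀
  numerator : + n * (+ n - + 1) ^ 2 * (+ n - + 2) ≡ (+ p - + 1) * (+ p - + 2) ^ 2 * (+ p - + 3)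
  numerator = trans (shift (+ n))
    (cong (λ k → (+ k - + 1) * (+ k - + 2) ^ 2 * (+ k - + 3)) suc-n≡p)
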